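{- Let $T \in (\Sigma \cup \Pi)^*$ be a p-string of length $n = |T| \ge 3$. Then $\mathsf{PDAWG}(T)$ has at most $2n-1$ nodes and at most $3n-4$ edges. These bounds are tight: for every $n \ge 3$ there are p-strings $T$ of length $n$ for which $\mathsf{PDAWG}(T)$ has exactly $2n-1$ nodes, and p-strings $T$ of length $n$ for which $\mathsf{PDAWG}(T)$ has exactly $3n-4$ edges.
   Context: $\Sigma$ (static symbols) and $\Pi$ (parameter symbols) are disjoint alphabets; a p-string is a string over $\Sigma \cup \Pi$. $\mathcal{N}$ is the set of non-negative integers (disjoint from $\Sigma$). For a string $w$, $w[i]$ is its $i$-th symbol, $w[i:j]$ the factor from position $i$ to $j$ ($=\varepsilon$ if $i>j$). The prev-encoding $\mathsf{prev}(S)$ of a p-string $S$ is the string over $\Sigma\cup\mathcal{N}$ of length $|S|$ with $\mathsf{prev}(S)[i]=S[i]$ if $S[i]\in\Sigma$; $=0$ if $S[i]\in\Pi$ and $S[i]\neq S[j]$ for all $j<i$; $=i-j$ if $S[i]=S[j]\in\Pi$ with $j<i$ and $S[i]\ne S[k]$ for all $j<k<i$. A pv-string is a string of the form $\mathsf{prev}(S)$. For $a\in\Sigma\cup\mathcal{N}$ and $j\in\mathcal{N}$ let $\mathsf{Z}(a,j)=0$ if $a\in\mathcal{N}$ and $a>j$, and $\mathsf{Z}(a,j)=a$ otherwise. The re-encoding of a factor $x$ of a pv-string is $\langle x\rangle$ with $\langle x\rangle[i]=\mathsf{Z}(x[i],i-1)$. For a pv-string $w$, $\mathsf{PFactor}(w)=\{\langle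 x\rangle : x \text{ a factor of } w\}$. $\mathsf{RPos}_w(x)=\{i\in\{0,\dots,|w|\} : x=\langle w[i-|x|+1:i]\rangle\}$; $x\equiv^R_w y$ iff $\mathsf{RPos}_w(x)=\mathsf{RPos}_w(y)$, with equivalence class $[x]^R_w$; for $x \in \mathsf{PFactor}(w)$ the class is finite with elements of distinct lengths and $\max[x]^R_w$ ($\min[x]^R_w$) denotes its longest (shortest) element. The PDAWG of $T$, with $w=\mathsf{prev}(T)$, is the directed graph $\mathsf{PDAWG}(T)=(V_w,E_w)$ with $V_w=\{[x]^R_w : x\in\mathsf{PFactor}(w)\}$ and $E_w=\{([x]^R_w,c,[y]^R_w)\in V_w\times(\Sigma\cup\mathcal{N})\times V_w : y=\max[x]^R_w\cdot c\}$.
   Formalization: Tightness is proved for alphabets that are large enough: for nodes, a static symbol and one further symbol (static or parameter); for edges, two static symbols and one further symbol. For smaller alphabets the claim can fail (e.g. no static symbols and one parameter). -}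

module Defs where

open import Data.Nat using (ℕ; zero; suc; _<_; _≤_; _<?_; _∸_)
open import Data.List using (List; []; _∷_; _++_; _∷ʳ_; length; take; drop)
open import Data.List.Relation.Unary.All using (All)
open import Data.List.Relation.Unary.Any using (Any)
open import Data.List.Relation.Unary.AllPairs using (AllPairs)
open import Data.Sum using (_⊎_; inj₁; inj₂)
open import Data.Product using (Σ; _×_; _,_; ∃; ∃-syntax)
open import Relation.Nullary using (¬_; yes; no)
open import Relation.Binary.PropositionalEquality using (_≡_)
open import Relation.Binary.Definitions using (DecidableEquality)

-- Σ : static symbols, Π : parameter symbols (disjointness is built in via ⊎).
-- P-strings are lists over Σ ⊎ Π; pv-strings are lists over Σ ⊎ ℕ.
module PDAWG (StSym : Set) (PaSym : Set) (_≟Π_ : DecidableEquality PaSym) where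

  PSym : Set
  PSym = StSym ⊎ PaSym

  PVSym : Set
  PVSym = StSym ⊎ ℕ

  -- distance (1-based) from the current position back to the most recent
  -- occurrence of parameter p; the history is given most-recent-first.
  -- 0 if p does not occur in the history.
  dist : PaSym → List PSym → ℕ
  dist p [] = 0
  dist p (inj₁ s ∷ h) with dist p h
  ... | zero = zero
  ... | suc d = suc (suc d)
  dist p (inj₂ q ∷ h) with p ≟Π q
  ... | yes _ = 1
  ... | no _ with dist p h
  ...   | zero = zero
  ...   | suc d = suc (suc d)

  prevFrom : List PSym → List PSym → List PVSym
  prevFrom h [] = []
  prevFrom h (inj₁ s ∷ S) = inj₁ s ∷ prevFrom (inj₁ s ∷ h) S
  prevFrom h (inj₂ p ∷ S) = inj₂ (dist p h) ∷ prevFrom (inj₂ p ∷ h) S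

  prev : List PSym → List PVSym
  prev S = prevFrom [] S

  Z : PVSym → ℕ → PVSym
  Z (inj₁ s) j = inj₁ s
  Z (inj₂ m) j with j <? m
  ... | yes _ = inj₂ 0
  ... | no _ = inj₂ m

  -- re-encoding ⟨x⟩, with ⟨x⟩[i] = Z(x[i], i-1) (1-based i), i.e.
  -- 0-based index k is mapped with Z(x[k], k)
  reencFrom : ℕ → List PVSym → List PVSym
  reencFrom k [] = []
  reencFrom k (a ∷ x) = Z a k ∷ reencFrom (suc k) x

  ⟨_⟩ : List PVSym → List PVSym
  ⟨ x ⟩ = reencFrom 0 x

  Factor : List PVSym → List PVSym → Set
  Factor w x = ∃[ u ] ∃[ v ] (w ≡ u ++ x ++ v)

  PFactor : List PVSym → List PVSym → Set
  PFactor w x = ∃[ y ] (Factor w y × x ≡ ⟨ y ⟩)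

  -- i ∈ RPos_w(x) : 0 ≤ i ≤ |w| and x = ⟨w[i-|x|+1 : i]⟩ (this factor
  -- must exist inside w, i.e. |x| ≤ i)
  RPos : List PVSym → List PVSym → ℕ → Set
  RPos w x i = i ≤ length w × length x ≤ i
             × x ≡ ⟨ take (length x) (drop (i ∸ length x) w) ⟩

  _≡R[_]_ : List PVSym → List PVSym → List PVSym → Set
  x ≡R[ w ] y = ∀ i → (RPos w x i → RPos w y i) × (RPos w y i → RPos w x i)

  IsMaxOf : List PVSym → List PVSym → List PVSym → Set
  IsMaxOf w x m = m ≡R[ w ] x × (∀ z → z ≡R[ w ] x → length z ≤ length m)

  -- Nodes of PDAWG(T): V_w = { [x]^R_w : x ∈ PFactor(w) }.
  -- A node is represented by any representative x ∈ PFactor(w); two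
  -- representatives denote the same node iff x ≡^R_w y.

  DistinctNodes : List PSym → List (List PVSym) → Set
  DistinctNodes T xs = All (PFactor (prev T)) xs
                     × AllPairs (λ x y → ¬ (x ≡R[ prev T ] y)) xs

  NodesAtMost : List PSym → ℕ → Set
  NodesAtMost T k = ∀ xs → DistinctNodes T xs → length xs ≤ k

  NodesExactly : List PSym → ℕ → Set
  NodesExactly T k = ∃[ xs ] (DistinctNodes T xs
                     × (∀ y → PFactor (prev T) y → Any (λ x → x ≡R[ prev T ] y) xs)
                     × length xs ≡ k)

  -- Edges of PDAWG(T): E_w = { ([x], c, [y]) ∈ V_w × (Σ ∪ 𝒩) × V_w :
  --                            y = max[x] · c }.
  -- An edge is represented by a triple (x , c , y) of representatives.

  Edge : Set
  Edge = List PVSym × PVSym × List PVSym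

  IsEdge : (w : List PVSym) → Edge → Set
  IsEdge w (x , c , y) = PFactor w x × PFactor w y
                       × ∃[ m ] (IsMaxOf w x m × (m ∷ʳ c) ≡R[ w ] y)

  SameEdge : (w : List PVSym) → Edge → Edge → Set
  SameEdge w (x , c , y) (x' , c' , y') = x ≡R[ w ] x' × c ≡ c' × y ≡R[ w ] y'

  DistinctEdges : List PSym → List Edge → Set
  DistinctEdges T es = All (IsEdge (prev T)) es
                     × AllPairs (λ e e' → ¬ SameEdge (prev T) e e') es

  EdgesAtMost : List PSym → ℕ → Set
  EdgesAtMost T k = ∀ es → DistinctEdges T es → length es ≤ k

  EdgesExactly : List PSym → ℕ → Set
  EdgesExactly T k = ∃[ es ] (DistinctEdges T es
                     × (∀ e → IsEdge (prev T) e → Any (λ e' → SameEdge (prev T) e' e) es)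
                     × length es ≡ k)

{-# OPTIONS --safe #-}
module Submission where

-- A node of w = prev(T) whose first occurrence can be extended to the left up to the start of w, in
-- agreement with all other occurrences,
-- is a prefix of w; otherwise, if j is the first end position at which the left extensions disagree, it
-- is the class of the longest suffix of w[1:j] that also ends earlier. Here 3 ≤ j ≤ n, whence at most
-- (n + 1) + (n - 2) nodes.
--
-- An edge is a string m c with m the maximum of its class. Either c follows the first occurrence of m,
-- and the edge is determined by the node of m, which is not w; or m c first occurs at a start s > 1,
-- where m is the longest prefix of w[s:n] that also starts earlier. This gives (2n - 2) + (n - 1)
-- edges, and one of these possibilities is always lost at the last letter of w.
--
-- The extremal texts are a uⁿ⁻¹ for nodes and a uⁿ⁻² b for edges.

open import Defs
open import Data.Nat using (ℕ; zero; suc; _+_; _*_; _∸_; _≤_; _<_; z≤n; s≤s; s≤s⁻¹; _≤?_; _<?_)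
open import Data.Nat.Properties
open import Data.Nat.Tactic.RingSolver using (solve-∀)
open import Data.Fin using (Fin; toℕ; fromℕ<; splitAt; join) renaming (zero to fzero; suc to fsuc; _<_ to _<ᶠ_)
open import Data.Fin.Properties using (pigeonhole; splitAt-join; toℕ-fromℕ<)
open import Data.List using (List; []; _∷_; _++_; _∷ʳ_; length; take; drop; applyUpTo; replicate; map; lookup)
open import Data.List.Properties using (length-applyUpTo; applyUpTo-∷ʳ; ∷-injective; ∷ʳ-injective)
open import Data.List.Properties using (length-++; length-map; length-replicate; take++drop≡id)
open import Data.List.Relation.Unary.All as All using (All; []; _∷_)
open import Data.List.Relation.Unary.Any using (Any; here; there)
open import Data.List.Relation.Unary.AllPairs using (AllPairs; []; _∷_)
import Data.List.Relation.Unary.All.Properties as Allₚ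
import Data.List.Relation.Unary.AllPairs.Properties as AllPairsₚ
open import Data.Sum as Sum using (_⊎_; inj₁; inj₂; [_,_]′)
open import Data.Sum.Properties using (inj₁-injective; inj₂-injective)
open import Data.Unit using (⊤; tt)
open import Data.Product using (_×_; _,_; ∃; ∃-syntax; proj₁; proj₂)
open import Data.Empty using (⊥; ⊥-elim)
open import Data.List.Membership.Propositional.Properties using (∈-lookup)
open import Function using (_∘_; id)
open import Relation.Nullary using (¬_; Dec; yes; no; contradiction)
open import Relation.Nullary.Decidable using (_×-dec_; _→-dec_; ¬?; decidable-stable; ¬¬-excluded-middle; map′)
open import Relation.Binary.PropositionalEquality using (_≡_; _≢_; refl; sym; trans; cong; cong₂; subst; subst₂)
open import Relation.Binary.Definitions using (DecidableEquality; tri<; tri≈; tri>)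

-- Bounded quantifiers and least witnesses.

-- A double-negation shift, constructive because the quantifier is bounded; it later supplies
-- decidable equality of the finitely many letters of a word under `¬ ¬`.
¬¬-bounded : {P : ℕ → Set} → ∀ N → (∀ k → ¬ ¬ P k) → ¬ ¬ (∀ k → k < N → P k)
¬¬-bounded zero    h r = r λ _ ()
¬¬-bounded {P} (suc N) h r = ¬¬-bounded N h λ below → h N λ pN →
  r λ k k<1+N → [ below k , (λ k≡N → subst P (sym k≡N) pN) ]′ (m<1+n⇒m<n∨m≡n k<1+N)

search : {P : ℕ → Set} → ∀ N → (∀ k → Dec (P k)) →
         (∀ k → k < N → ¬ P k) ⊎ ∃[ k ] (k < N × P k × (∀ j → j < k → ¬ P j))
search zero P? = inj₁ λ _ ()
search (suc N) P? with search N P?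
... | inj₂ (k , k<N , pk , least) = inj₂ (k , m<n⇒m<1+n k<N , pk , least)
... | inj₁ none with P? N
...   | yes pN = inj₂ (N , ≤-refl , pN , none)
...   | no ¬pN = inj₁ λ k k<1+N pk →
        [ (λ k<N → none k k<N pk) , (λ { refl → ¬pN pk }) ]′ (m<1+n⇒m<n∨m≡n k<1+N)

least : {P : ℕ → Set} → (∀ k → Dec (P k)) → ∀ {m} → P m →
        ∃[ k ] (k ≤ m × P k × (∀ j → j < k → ¬ P j))
least P? {m} pm with search (suc m) P?
... | inj₁ none = contradiction pm (none m ≤-refl)
... | inj₂ (k , k<1+m , pk , lst) = k , s≤s⁻¹ k<1+m , pk , lst

-- Counting pairwise distinct elements by codes.

allPairs-lookup : {A : Set} {R : A → A → Set} {xs : List A} → AllPairs R xs →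
                  ∀ i j → i <ᶠ j → R (lookup xs i) (lookup xs j)
allPairs-lookup (px ∷ _)  fzero    (fsuc j) _         = All.lookup px (∈-lookup j)
allPairs-lookup (_ ∷ pxs) (fsuc i) (fsuc j) (s≤s i<j) = allPairs-lookup pxs i j i<j

-- Codes are plain numbers with their ranges kept apart, so that one coding of the edges can be
-- counted with two different choices of ranges.
Within : ℕ → ℕ → ℕ → ℕ ⊎ ℕ ⊎ ℕ → Set
Within p q r (inj₁ i)        = i < p
Within p q r (inj₂ (inj₁ j)) = j < q
Within p q r (inj₂ (inj₂ k)) = k < r

module _ {A : Set} {P : A → Set} {_~_ : A → A → Set} where

  -- By the pigeonhole principle. `Code` is a relation: an element may have several codes, and it
  -- only matters that a code determines its element up to `~`.
  distinct⇒≤codes : ∀ {N} (Code : A → Fin N → Set) →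
    (∀ {x} → P x → ∃ (Code x)) → (∀ {x y k} → Code x k → Code y k → x ~ y) →
    ∀ xs → All P xs → AllPairs (λ x y → ¬ (x ~ y)) xs → length xs ≤ N
  distinct⇒≤codes {N} Code code func xs Pxs distinct with length xs ≤? N
  ... | yes ≤N = ≤N
  ... | no ≰N
    with i , j , i<j , eq ← pigeonhole (≰⇒> ≰N) (λ i → proj₁ (code (All.lookup Pxs (∈-lookup i))))
    = contradiction
        (func (proj₂ (code (All.lookup Pxs (∈-lookup i))))
              (subst (Code _) (sym eq) (proj₂ (code (All.lookup Pxs (∈-lookup j))))))
        (allPairs-lookup distinct i j i<j)

  distinct⇒≤sum : ∀ p q r (Code : A → ℕ ⊎ ℕ ⊎ ℕ → Set) →
    (∀ {x} → P x → ∃[ k ] (Within p q r k × Code x k)) → (∀ {x y k} → Code x k → Code y k → x ~ y) →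
    ∀ xs → All P xs → AllPairs (λ x y → ¬ (x ~ y)) xs → length xs ≤ p + (q + r)
  distinct⇒≤sum p q r Code code func = distinct⇒≤codes (λ x → Code x ∘ decode)
    (λ px → let k , within , c = code px
                i , eq = decode-surjective k within
            in i , subst (Code _) (sym eq) c)
    func
    where
    decode : Fin (p + (q + r)) → ℕ ⊎ ℕ ⊎ ℕ
    decode = Sum.map toℕ (Sum.map toℕ toℕ ∘ splitAt q) ∘ splitAt p
    decode-surjective : ∀ k → Within p q r k → ∃[ i ] decode i ≡ k
    decode-surjective (inj₁ i) i<p = join p (q + r) (inj₁ (fromℕ< i<p)) , eq
      where
      eq : decode (join p (q + r) (inj₁ (fromℕ< i<p))) ≡ inj₁ i
      eq rewrite splitAt-join p (q + r) (inj₁ (fromℕ< i<p)) = cong inj₁ (toℕ-fromℕ< i<p)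
    decode-surjective (inj₂ (inj₁ j)) j<q = join p (q + r) (inj₂ (join q r (inj₁ (fromℕ< j<q)))) , eq
      where
      eq : decode (join p (q + r) (inj₂ (join q r (inj₁ (fromℕ< j<q))))) ≡ inj₂ (inj₁ j)
      eq rewrite splitAt-join p (q + r) (inj₂ (join q r (inj₁ (fromℕ< j<q)))) | splitAt-join q r (inj₁ (fromℕ< j<q)) =
        cong (inj₂ ∘ inj₁) (toℕ-fromℕ< j<q)
    decode-surjective (inj₂ (inj₂ k)) k<r = join p (q + r) (inj₂ (join q r (inj₂ (fromℕ< k<r)))) , eq
      where
      eq : decode (join p (q + r) (inj₂ (join q r (inj₂ (fromℕ< k<r))))) ≡ inj₂ (inj₂ k)
      eq rewrite splitAt-join p (q + r) (inj₂ (join q r (inj₂ (fromℕ< k<r)))) | splitAt-join q r (inj₂ (fromℕ< k<r)) =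
        cong (inj₂ ∘ inj₂) (toℕ-fromℕ< k<r)

  any~? : (∀ {x y} → P x → P y → Dec (x ~ y)) →
          ∀ {y} → P y → ∀ {xs} → All P xs → Dec (Any (_~ y) xs)
  any~? dec py [] = no λ ()
  any~? dec py (px ∷ pxs) with dec px py
  ... | yes x~y = yes (here x~y)
  ... | no ¬x~y = map′ there (λ { (here x~y) → contradiction x~y ¬x~y ; (there a) → a }) (any~? dec py pxs)

  -- An element missing from the list could be prepended to it.
  maximal⇒exhaustive : (∀ {x y} → P x → P y → Dec (x ~ y)) → (∀ {x y} → x ~ y → y ~ x) →
    ∀ xs → All P xs → AllPairs (λ x y → ¬ (x ~ y)) xs →
    (∀ ys → All P ys → AllPairs (λ x y → ¬ (x ~ y)) ys → length ys ≤ length xs) →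
    ∀ y → P y → Any (_~ y) xs
  maximal⇒exhaustive dec ~-sym xs Pxs distinct bound y py with any~? dec py Pxs
  ... | yes found = found
  ... | no missing = contradiction
    (bound (y ∷ xs) (py ∷ Pxs) (All.map (_∘ ~-sym) (Allₚ.¬Any⇒All¬ xs missing) ∷ distinct))
    (<⇒≱ ≤-refl)

applyUpTo-cong : {A : Set} {f g : ℕ → A} → ∀ n → (∀ q → q < n → f q ≡ g q) → applyUpTo f n ≡ applyUpTo g n
applyUpTo-cong zero    h = refl
applyUpTo-cong (suc n) h = cong₂ _∷_ (h 0 (s≤s z≤n)) (applyUpTo-cong n λ q → h (suc q) ∘ s≤s)

applyUpTo-injective : {A : Set} {f g : ℕ → A} → ∀ n → applyUpTo f n ≡ applyUpTo g n → ∀ q → q < n → f q ≡ g q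
applyUpTo-injective (suc n) eq zero    _         = proj₁ (∷-injective eq)
applyUpTo-injective (suc n) eq (suc q) (s≤s q<n) = applyUpTo-injective n (proj₂ (∷-injective eq)) q q<n

-- Re-encoding of letters and words.

module Words (StSym PaSym : Set) (_≟Π_ : DecidableEquality PaSym) where
  open PDAWG StSym PaSym _≟Π_

  -- A reference that reaches back beyond `k` also reaches beyond `j`. Hence re-encoding a factor of
  -- a re-encoded factor gives the same as re-encoding it directly.
  Z-Z : ∀ c {j k} → j ≤ k → Z (Z c k) j ≡ Z c j
  Z-Z (inj₁ s) _ = refl
  Z-Z (inj₂ m) {j} {k} j≤k with k <? m
  ... | no _ = refl
  ... | yes k<m with j <? m
  ...   | yes _ = refl
  ...   | no j≮m = contradiction (≤-<-trans j≤k k<m) j≮m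

  Z-static : ∀ {s} c q → Z c q ≡ inj₁ s → c ≡ inj₁ s
  Z-static (inj₁ _) q eq = eq
  Z-static (inj₂ m) q eq with q <? m
  Z-static (inj₂ m) q () | yes _
  Z-static (inj₂ m) q () | no _

  -- Re-encoding fixes static symbols and keeps numbers numbers, so the hypothesis settles the
  -- static case and arithmetic the numeric one.
  Z≡? : ∀ c d q → Dec (c ≡ d) → Dec (Z c q ≡ Z d q)
  Z≡? c        d        q (yes refl) = yes refl
  Z≡? (inj₁ s) d        q (no c≢d) = no λ eq → c≢d (sym (Z-static d q (sym eq)))
  Z≡? c@(inj₂ _) (inj₁ t) q (no c≢d) = no λ eq → c≢d (Z-static c q eq)
  Z≡? (inj₂ m) (inj₂ k) q (no _) with q <? m | q <? k
  ... | yes _ | yes _ = yes refl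
  ... | yes _ | no _  = map′ (cong inj₂) (λ { refl → refl }) (0 ≟ k)
  ... | no _  | yes _ = map′ (cong inj₂) (λ { refl → refl }) (m ≟ 0)
  ... | no _  | no _  = map′ (cong inj₂) (λ { refl → refl }) (m ≟ k)

  -- Zero-based; the value beyond the end of the word is junk.
  at : List PVSym → ℕ → PVSym
  at []      _       = inj₂ 0
  at (c ∷ w) zero    = c
  at (c ∷ w) (suc p) = at w p

  reencFrom-applyUpTo : ∀ k (f : ℕ → PVSym) l → reencFrom k (applyUpTo f l) ≡ applyUpTo (λ q → Z (f q) (k + q)) l
  reencFrom-applyUpTo k f zero    = refl
  reencFrom-applyUpTo k f (suc l) = cong₂ _∷_ (cong (Z (f 0)) (sym (+-identityʳ k)))
    (trans (reencFrom-applyUpTo (suc k) (f ∘ suc) l)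
           (applyUpTo-cong l λ q _ → cong (Z (f (suc q))) (sym (+-suc k q))))

  take-drop-at : ∀ w s l → s + l ≤ length w → take l (drop s w) ≡ applyUpTo (λ q → at w (s + q)) l
  take-drop-at w       zero    zero    _       = refl
  take-drop-at (c ∷ w) zero    (suc l) (s≤s h) = cong (c ∷_) (take-drop-at w zero l h)
  take-drop-at (c ∷ w) (suc s) l       (s≤s h) = take-drop-at w s l h

  -- `NodesExactly` with an arbitrary word in place of `prev T`, so that a count for an explicit
  -- word can be transported along the computation of its encoding.
  ExactNodes : List PVSym → ℕ → Set
  ExactNodes w k = ∃[ xs ] ((All (PFactor w) xs × AllPairs (λ x y → ¬ (x ≡R[ w ] y)) xs)
    × (∀ y → PFactor w y → Any (λ x → x ≡R[ w ] y) xs) × length xs ≡ k)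

  ExactEdges : List PVSym → ℕ → Set
  ExactEdges w k = ∃[ es ] ((All (IsEdge w) es × AllPairs (λ e e′ → ¬ SameEdge w e e′) es)
    × (∀ e → IsEdge w e → Any (λ e′ → SameEdge w e′ e) es) × length es ≡ k)

  -- Factors, matches and end positions in a fixed word.

  module Word (w : List PVSym) where

    n : ℕ
    n = length w

    fac : ℕ → ℕ → List PVSym
    fac s l = applyUpTo (λ q → Z (at w (s + q)) q) l

    length-fac : ∀ s l → length (fac s l) ≡ l
    length-fac s l = length-applyUpTo _ l

    fac-∷ʳ : ∀ s l → fac s l ∷ʳ Z (at w (s + l)) l ≡ fac s (suc l)
    fac-∷ʳ s l = applyUpTo-∷ʳ _ l

    ⟨take-drop⟩ : ∀ s l → s + l ≤ n → ⟨ take l (drop s w) ⟩ ≡ fac s l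
    ⟨take-drop⟩ s l h = trans (cong ⟨_⟩ (take-drop-at w s l h)) (reencFrom-applyUpTo 0 _ l)

    -- Equality of `fac s l` and `fac t l` letter by letter; that both lie inside the word is left
    -- to the context.
    Match : ℕ → ℕ → ℕ → Set
    Match l s t = ∀ q → q < l → Z (at w (s + q)) q ≡ Z (at w (t + q)) q

    Match⇒fac≡ : ∀ {l s t} → Match l s t → fac s l ≡ fac t l
    Match⇒fac≡ {l} = applyUpTo-cong l

    fac≡⇒Match : ∀ l s t → fac s l ≡ fac t l → Match l s t
    fac≡⇒Match l s t = applyUpTo-injective l

    fac-injective : ∀ {l k s t} → fac s l ≡ fac t k → l ≡ k × Match l s t
    fac-injective {l} {k} {s} {t} eq with trans (sym (length-fac s l)) (trans (cong length eq) (length-fac t k))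
    ... | refl = refl , fac≡⇒Match l s t eq

    Match-refl : ∀ {l s} → Match l s s
    Match-refl _ _ = refl

    Match-sym : ∀ {l s t} → Match l s t → Match l t s
    Match-sym m q q< = sym (m q q<)

    Match-trans : ∀ {l s t r} → Match l s t → Match l t r → Match l s r
    Match-trans m m′ q q< = trans (m q q<) (m′ q q<)

    Match-prefix : ∀ {l s t} → Match (suc l) s t → Match l s t
    Match-prefix m q q< = m q (m<n⇒m<1+n q<)

    -- Deleting letters on the left can only turn further references into 0, by `Z-Z`, so equal
    -- factors stay equal. Extending to the left has no such guarantee.
    Match-drop : ∀ d {l s t} → Match (d + l) s t → Match l (d + s) (d + t)
    Match-drop d {l} {s} {t} m q q<l =
      trans (sym (step s)) (trans (cong (λ c → Z c q) (m (d + q) (+-monoʳ-< d q<l))) (step t))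
      where
      step : ∀ r → Z (Z (at w (r + (d + q))) (d + q)) q ≡ Z (at w (d + r + q)) q
      step r = trans (Z-Z (at w (r + (d + q))) (m≤n+m q d))
        (cong (λ p → Z (at w p) q) (trans (sym (+-assoc r d q)) (cong (_+ q) (+-comm r d))))

    End : ℕ → ℕ → ℕ → Set
    End s l i = ∃[ t ] (t + l ≡ i × i ≤ n × Match l t s)

    RPos⇒fac : ∀ {x i} → RPos w x i → ∃[ t ] (t + length x ≡ i × i ≤ n × x ≡ fac t (length x))
    RPos⇒fac {x} {i} (i≤n , l≤i , eq) = i ∸ length x , m∸n+n≡m l≤i , i≤n ,
      trans eq (⟨take-drop⟩ (i ∸ length x) (length x) (≤-trans (≤-reflexive (m∸n+n≡m l≤i)) i≤n))

    RPos-∷ʳ : ∀ m {c i} → RPos w (m ∷ʳ c) i →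
              ∃[ t ] (t + suc (length m) ≡ i × i ≤ n × m ∷ʳ c ≡ fac t (suc (length m)))
    RPos-∷ʳ m {c} {i} r = subst (λ k → ∃[ t ] (t + k ≡ i × i ≤ n × m ∷ʳ c ≡ fac t k))
      (trans (length-++ m) (+-comm (length m) 1)) (RPos⇒fac r)

    RPos⇒End : ∀ {s l i} → RPos w (fac s l) i → End s l i
    RPos⇒End {s} {l} {i} r with RPos⇒fac r
    ... | t , t+l≡i , i≤n , eq rewrite length-fac s l = t , t+l≡i , i≤n , fac≡⇒Match l t s (sym eq)

    End⇒RPos : ∀ {s l i} → End s l i → RPos w (fac s l) i
    End⇒RPos {s} {l} (t , refl , i≤n , m) rewrite length-fac s l | m+n∸n≡m t l =
      i≤n , m≤n+m l t , trans (sym (Match⇒fac≡ m)) (sym (⟨take-drop⟩ t l i≤n))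

    End-self : ∀ {s l} → s + l ≤ n → End s l (s + l)
    End-self h = _ , refl , h , Match-refl

    RPos-unique : ∀ {x y i} → RPos w x i → RPos w y i → length x ≡ length y → x ≡ y
    RPos-unique (_ , _ , eq) (_ , _ , eq′) l≡ rewrite l≡ = trans eq (sym eq′)

    PFactor⇒fac : ∀ {x} → PFactor w x → ∃[ s ] ∃[ l ] (s + l ≤ n × x ≡ fac s l)
    PFactor⇒fac (y , (u , v , refl) , refl) = length u , length y , bound ,
      trans (cong ⟨_⟩ (sym (split u))) (⟨take-drop⟩ (length u) (length y) bound)
      where
      take-++ : ∀ (y : List PVSym) {v} → take (length y) (y ++ v) ≡ y
      take-++ []      = refl
      take-++ (c ∷ y) = cong (c ∷_) (take-++ y)
      split : ∀ u → take (length y) (drop (length u) (u ++ y ++ v)) ≡ y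
      split []      = take-++ y
      split (c ∷ u) = split u
      bound : length u + length y ≤ length (u ++ y ++ v)
      bound rewrite length-++ u {y ++ v} | length-++ y {v} = +-monoʳ-≤ (length u) (m≤m+n (length y) (length v))

    fac-PFactor : ∀ s l → s + l ≤ n → PFactor w (fac s l)
    fac-PFactor s l h = take l (drop s w) ,
      (take s w , drop l (drop s w) ,
        sym (trans (cong (take s w ++_) (take++drop≡id l (drop s w))) (take++drop≡id s w))) ,
      sym (⟨take-drop⟩ s l h)

    ≡R-refl : ∀ {x} → x ≡R[ w ] x
    ≡R-refl i = id , id

    ≡R-reflexive : ∀ {x y} → x ≡ y → x ≡R[ w ] y
    ≡R-reflexive refl = ≡R-refl

    ≡R-sym : ∀ {x y} → x ≡R[ w ] y → y ≡R[ w ] x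
    ≡R-sym e i = proj₂ (e i) , proj₁ (e i)

    ≡R-trans : ∀ {x y z} → x ≡R[ w ] y → y ≡R[ w ] z → x ≡R[ w ] z
    ≡R-trans e f i = proj₁ (f i) ∘ proj₁ (e i) , proj₂ (e i) ∘ proj₂ (f i)

    End⇔⇒≡R : ∀ {s l t k} → (∀ {i} → End s l i → End t k i) → (∀ {i} → End t k i → End s l i) →
              fac s l ≡R[ w ] fac t k
    End⇔⇒≡R f g i = End⇒RPos ∘ f ∘ RPos⇒End , End⇒RPos ∘ g ∘ RPos⇒End

    ≡R⇒End : ∀ {s l t k i} → fac s l ≡R[ w ] fac t k → End s l i → End t k i
    ≡R⇒End {i = i} e = RPos⇒End ∘ proj₁ (e i) ∘ End⇒RPos

    -- Both are factors of the same length ending at a common position.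
    IsMaxOf-unique : ∀ {x y m m′} → PFactor w x → x ≡R[ w ] y → IsMaxOf w x m → IsMaxOf w y m′ → m ≡ m′
    IsMaxOf-unique px x≡y (m≡x , m-max) (m′≡y , m′-max) with PFactor⇒fac px
    ... | s , l , h , refl =
      RPos-unique (proj₂ (m≡x (s + l)) pos) (proj₂ (m′≡y (s + l)) (proj₁ (x≡y (s + l)) pos))
        (≤-antisym (m′-max _ (≡R-trans m≡x x≡y)) (m-max _ (≡R-trans m′≡y (≡R-sym x≡y))))
      where
      pos : RPos w (fac s l) (s + l)
      pos = End⇒RPos (End-self h)

    -- Codes for nodes and edges.

    -- fac (suc t) l is the longest suffix of the prefix of length suc t + l that also ends earlier.
    LRS : ℕ → ℕ → Set
    LRS t l = suc t + l ≤ n × (∃[ s ] (s < suc t × Match l s (suc t))) × (∀ s → s < t → ¬ Match (suc l) s t)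

    -- Otherwise the suffix of length `suc l` of the longer repetition would itself repeat, against
    -- the maximality of `l`.
    LRS-length-≤ : ∀ {t l t′ l′} → LRS t l → LRS t′ l′ → suc t + l ≡ suc t′ + l′ → l′ ≤ l
    LRS-length-≤ {t} {l} {t′} {l′} (_ , _ , longest) (_ , (s , s<t′ , m) , _) ends≡ = ≮⇒≥ λ l<l′ →
      let d = l′ ∸ suc l
          d+1+l≡l′ = m∸n+n≡m l<l′
          d+t′≡t : d + suc t′ ≡ t
          d+t′≡t = +-cancelʳ-≡ (suc l) _ _ (trans (cong (_+ suc l) (+-comm d (suc t′)))
            (trans (+-assoc (suc t′) d (suc l)) (trans (cong (suc t′ +_) d+1+l≡l′)
            (trans (sym ends≡) (sym (+-suc t l))))))
      in longest (d + s) (subst (d + s <_) d+t′≡t (+-monoʳ-< d s<t′))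
           (subst (Match (suc l) (d + s)) d+t′≡t
             (Match-drop d (subst (λ k → Match k s (suc t′)) (sym d+1+l≡l′) m)))

    LRS-unique : ∀ {t l t′ l′} → LRS t l → LRS t′ l′ → suc t + l ≡ suc t′ + l′ → t ≡ t′ × l ≡ l′
    LRS-unique {t} {l} lrs lrs′ ends≡
      with ≤-antisym (LRS-length-≤ lrs′ lrs (sym ends≡)) (LRS-length-≤ lrs lrs′ ends≡)
    ... | refl = suc-injective (+-cancelʳ-≡ l _ _ ends≡) , refl

    First : ℕ → ℕ → Set
    First s l = ∀ t → t < s → ¬ Match l t s

    -- The value at `s` of the longest-previous-factor table; it is used only where `s + l < n`.
    LCP : ℕ → ℕ → Set
    LCP s l = (∃[ t ] (t < s × Match l t s)) × First s (suc l)

    LCP-length-≤ : ∀ {s l l′} → LCP s l → LCP s l′ → l′ ≤ l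
    LCP-length-≤ (_ , fresh) ((t , t<s , m) , _) = ≮⇒≥ λ l<l′ → fresh t t<s λ q q< → m q (<-≤-trans q< l<l′)

    -- The code inj₁ i is the prefix of length i, inj₂ j the longest repeated suffix of the prefix of length 3 + j.
    NodeCode : List PVSym → ℕ ⊎ ℕ → Set
    NodeCode x (inj₁ i) = i ≤ n × x ≡R[ w ] fac 0 i
    NodeCode x (inj₂ j) = ∃[ t ] ∃[ l ] (LRS t l × 1 ≤ l × suc t + l ≡ 3 + j × x ≡R[ w ] fac (suc t) l)

    NodeCode-functional : ∀ {x y} k → NodeCode x k → NodeCode y k → x ≡R[ w ] y
    NodeCode-functional (inj₁ i) (_ , e) (_ , f) = ≡R-trans e (≡R-sym f)
    NodeCode-functional (inj₂ j) (t , l , lrs , _ , end , e) (t′ , l′ , lrs′ , _ , end′ , f)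
      with LRS-unique lrs lrs′ (trans end (sym end′))
    ... | refl , refl = ≡R-trans e (≡R-sym f)

    NodeCode-resp : ∀ {x y} k → x ≡R[ w ] y → NodeCode y k → NodeCode x k
    NodeCode-resp (inj₁ i) e (i≤n , f) = i≤n , ≡R-trans e f
    NodeCode-resp (inj₂ j) e (t , l , lrs , 1≤l , end , f) = t , l , lrs , 1≤l , end , ≡R-trans e f

    EdgeAt : Edge → ℕ → ℕ → Set
    EdgeAt (x , c , y) s l = s + l < n × PFactor w x × IsMaxOf w x (fac s l) ×
                             c ≡ Z (at w (s + l)) l × fac s (suc l) ≡R[ w ] y

    -- The string `m c` determines the edge: `m` represents the source, `c` is the label and `m c`
    -- represents the target.
    fac≡⇒SameEdge : ∀ {e e′ s l s′ l′} → EdgeAt e s l → EdgeAt e′ s′ l′ →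
                    fac s (suc l) ≡ fac s′ (suc l′) → SameEdge w e e′
    fac≡⇒SameEdge (_ , _ , (m≡x , _) , refl , y≡) (_ , _ , (m≡x′ , _) , refl , y≡′) eq with fac-injective eq
    ... | refl , m = ≡R-trans (≡R-sym m≡x) (≡R-trans (≡R-reflexive (Match⇒fac≡ (Match-prefix m))) m≡x′) ,
                     m _ ≤-refl ,
                     ≡R-trans (≡R-sym y≡) (≡R-trans (≡R-reflexive eq) y≡′)

    -- Conversely the source has only one maximum `m`, and the label adds `c`.
    SameEdge⇒fac≡ : ∀ {e e′ s l s′ l′} → EdgeAt e s l → EdgeAt e′ s′ l′ →
                    SameEdge w e e′ → fac s (suc l) ≡ fac s′ (suc l′)
    SameEdge⇒fac≡ {s = s} {l} {s′} {l′} (_ , px , max , refl , _) (_ , _ , max′ , refl , _) (x≡x′ , c≡c′ , _) =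
      trans (sym (fac-∷ʳ s l)) (trans (cong₂ _∷ʳ_ (IsMaxOf-unique px x≡x′ max max′) c≡c′) (fac-∷ʳ s′ l′))

    SameEdge-sym : ∀ {e e′} → SameEdge w e e′ → SameEdge w e′ e
    SameEdge-sym (x≡ , c≡ , y≡) = ≡R-sym x≡ , sym c≡ , ≡R-sym y≡

    -- If `c` follows the first occurrence of `m`, the code is that of the node of `m`. Otherwise it
    -- is the start `suc s` lowered by one, since nothing starts before 0.
    EdgeCode : Edge → ℕ ⊎ ℕ ⊎ ℕ → Set
    EdgeCode e (inj₁ i)        = ∃[ s ] ∃[ l ] (EdgeAt e s l × First s l × NodeCode (fac s l) (inj₁ i))
    EdgeCode e (inj₂ (inj₁ j)) = ∃[ s ] ∃[ l ] (EdgeAt e s l × First s l × NodeCode (fac s l) (inj₂ j))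
    EdgeCode e (inj₂ (inj₂ s)) = ∃[ l ] (EdgeAt e (suc s) l × LCP (suc s) l)

    First-unique : ∀ {s t l} → Match l s t → First s l → First t l → s ≡ t
    First-unique {s} {t} m fs ft with <-cmp s t
    ... | tri< s<t _ _ = contradiction m (ft s s<t)
    ... | tri≈ _ s≡t _ = s≡t
    ... | tri> _ _ t<s = contradiction (Match-sym m) (fs t t<s)

    -- Equal classes have the same maximum; its first occurrence is unique and is followed by a
    -- single letter.
    first-edges-same : ∀ {e e′ s l s′ l′} → EdgeAt e s l → EdgeAt e′ s′ l′ → First s l → First s′ l′ →
                       fac s l ≡R[ w ] fac s′ l′ → SameEdge w e e′
    first-edges-same at₁@(_ , px , max@(m≡x , _) , _) at₂@(_ , _ , max′@(m≡x′ , _) , _) first first′ m≡m′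
      with fac-injective (IsMaxOf-unique px (≡R-trans (≡R-sym m≡x) (≡R-trans m≡m′ m≡x′)) max max′)
    ... | refl , m with First-unique m first first′
    ...   | refl = fac≡⇒SameEdge at₁ at₂ refl

    EdgeCode-functional : ∀ {e e′} k → EdgeCode e k → EdgeCode e′ k → SameEdge w e e′
    EdgeCode-functional (inj₁ i) (_ , _ , at₁ , f , c) (_ , _ , at₂ , f′ , c′) =
      first-edges-same at₁ at₂ f f′ (NodeCode-functional (inj₁ i) c c′)
    EdgeCode-functional (inj₂ (inj₁ j)) (_ , _ , at₁ , f , c) (_ , _ , at₂ , f′ , c′) =
      first-edges-same at₁ at₂ f f′ (NodeCode-functional (inj₂ j) c c′)
    EdgeCode-functional (inj₂ (inj₂ s)) (_ , at₁ , lcp) (_ , at₂ , lcp′)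
      with ≤-antisym (LCP-length-≤ lcp′ lcp) (LCP-length-≤ lcp lcp′)
    ... | refl = fac≡⇒SameEdge at₁ at₂ refl

    -- Decision procedures and codes, given decidable equality of the letters in the word.

    module DecidableLetters (letter? : ∀ p p′ → p < n → p′ < n → Dec (at w p ≡ at w p′)) where

      match? : ∀ l s t → s + l ≤ n → t + l ≤ n → Dec (Match l s t)
      match? zero    s t _  _  = yes λ _ ()
      match? (suc l) s t hs ht =
        map′ (λ { (m , last) q q<1+l → [ m q , (λ { refl → last }) ]′ (m<1+n⇒m<n∨m≡n q<1+l) })
             (λ m → Match-prefix m , m l ≤-refl)
             (match? l s t (<⇒≤ hs′) (<⇒≤ ht′) ×-dec Z≡? _ _ l (letter? (s + l) (t + l) hs′ ht′))
        where
        hs′ : s + l < n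
        hs′ = subst (_≤ n) (+-suc s l) hs
        ht′ : t + l < n
        ht′ = subst (_≤ n) (+-suc t l) ht

      occ? : ∀ l s → s + l ≤ n → ∀ t → Dec (t + l ≤ n × Match l t s)
      occ? l s hs t with t + l ≤? n
      ... | no t≰ = no λ (h , _) → t≰ h
      ... | yes ht = map′ (ht ,_) proj₂ (match? l t s ht hs)

      first-occurrence : ∀ s l → s + l ≤ n → ∃[ t ] (t + l ≤ n × Match l t s × First t l)
      first-occurrence s l hs with least (occ? l s hs) (hs , Match-refl)
      ... | t , t≤s , (ht , m) , lst = t , ht , m ,
        λ r r<t m′ → lst r r<t (≤-trans (+-monoˡ-≤ l (<⇒≤ r<t)) ht , Match-trans m′ m)

      -- Extend the first occurrence to the left for as long as all occurrences extend alike.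
      first⇒NodeCode : ∀ s l → s + l ≤ n → First s l → ∃ (NodeCode (fac s l))
      first⇒NodeCode zero l h _ = inj₁ l , h , ≡R-refl
      first⇒NodeCode (suc s) l h first with search n disagrees?
        where
        hs : s + suc l ≤ n
        hs = subst (_≤ n) (sym (+-suc s l)) h
        disagrees? : ∀ t → Dec (suc t + l ≤ n × Match l (suc t) (suc s) × ¬ Match (suc l) t s)
        disagrees? t with suc t + l ≤? n
        ... | no t≰ = no λ (ht , _) → t≰ ht
        ... | yes ht = map′ (ht ,_) proj₂
          (match? l (suc t) (suc s) ht h ×-dec ¬? (match? (suc l) t s (subst (_≤ n) (sym (+-suc t l)) ht) hs))
      -- The end `suc t + l` is at least 3, since `s < t` and `1 ≤ l`; this accounts for the
      -- subtraction of 2.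
      ... | inj₂ (t , _ , (ht , m , ¬m) , lst) = inj₂ (t + l ∸ 2) , t , l ,
              (ht , (suc s , s≤s s<t , Match-sym m) , longest) , 1≤l , end ,
              End⇔⇒≡R (λ (r , e , i≤n , mr) → r , e , i≤n , Match-trans mr (Match-sym m))
                      (λ (r , e , i≤n , mr) → r , e , i≤n , Match-trans mr m)
        where
        s<t : s < t
        s<t with <-cmp s t
        ... | tri< s<t _ _ = s<t
        ... | tri≈ _ refl _ = contradiction (Match-refl {suc l} {s}) ¬m
        ... | tri> _ _ t<s = ⊥-elim (first (suc t) (s≤s t<s) m)
        1≤l : 1 ≤ l
        1≤l = n≢0⇒n>0 λ { refl → first 0 (s≤s z≤n) λ _ () }
        longest : ∀ r → r < t → ¬ Match (suc l) r t
        -- A longer repetition, from `r`, would make `suc r` an earlier occurrence with the same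
        -- disagreeing left extension as `suc t`.
        longest r r<t m′ = lst r r<t
          ( ≤-trans (+-monoˡ-≤ l (s≤s (<⇒≤ r<t))) ht
          , Match-trans (Match-drop 1 m′) m
          , λ m″ → ¬m (Match-trans (Match-sym m′) m″) )
        end : suc t + l ≡ 3 + (t + l ∸ 2)
        end = cong suc (sym (m+[n∸m]≡n (+-mono-≤ (≤-<-trans z≤n s<t) 1≤l)))
      ... | inj₁ agree =
        -- The longer string again has its first occurrence at `s`: an earlier one would contain an
        -- earlier occurrence of the shorter string.
        let k , c = first⇒NodeCode s (suc l) hs λ t t<s m → first (suc t) (s≤s t<s) (Match-drop 1 m)
        in k , NodeCode-resp k (End⇔⇒≡R left right) c
        where
        hs : s + suc l ≤ n
        hs = subst (_≤ n) (sym (+-suc s l)) h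
        left : ∀ {i} → End (suc s) l i → End s (suc l) i
        left (zero , _ , _ , m) = ⊥-elim (first 0 (s≤s z≤n) m)
        left {i} (suc t , refl , i≤n , m) with match? (suc l) t s (subst (_≤ n) (sym (+-suc t l)) i≤n) hs
        ... | yes m′ = t , +-suc t l , i≤n , m′
        ... | no ¬m = ⊥-elim (agree t (≤-trans (m≤m+n (suc t) l) i≤n) (i≤n , m , ¬m))
        right : ∀ {i} → End s (suc l) i → End (suc s) l i
        right (t , refl , i≤n , m) = suc t , sym (+-suc t l) , i≤n , Match-drop 1 m

      PFactor⇒NodeCode : ∀ {x} → PFactor w x → ∃ (NodeCode x)
      PFactor⇒NodeCode px with PFactor⇒fac px
      ... | s , l , h , refl with first-occurrence s l h
      ...   | t , ht , m , first with first⇒NodeCode t l ht first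
      ...     | k , c = k , subst (λ x → NodeCode x k) (Match⇒fac≡ m) c

      -- The string `m c` ends wherever the factor `y` does, hence is itself a factor; `s` is the
      -- start of its first occurrence.
      IsEdge⇒EdgeAt : ∀ {e} → IsEdge w e → ∃[ s ] ∃[ l ] (EdgeAt e s l × First s (suc l))
      IsEdge⇒EdgeAt {x , c , y} (px , py , m , max , mc≡y) with PFactor⇒fac py
      ... | s₀ , l₀ , h₀ , refl
        with RPos-∷ʳ m (proj₂ (mc≡y (s₀ + l₀)) (End⇒RPos (End-self h₀)))
      ... | t , end , h , eq
        with first-occurrence t (suc (length m)) (≤-trans (≤-reflexive end) h)
      ... | s , hs , match , first
        with ∷ʳ-injective m (fac s (length m))
               (trans eq (trans (sym (Match⇒fac≡ match)) (sym (fac-∷ʳ s (length m)))))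
      ... | m≡ , c≡ = s , length m ,
        ( subst (_≤ n) (+-suc s (length m)) hs , px , subst (IsMaxOf w x) m≡ max , c≡
        , ≡R-trans (≡R-reflexive (trans (Match⇒fac≡ match) (sym eq))) mc≡y ) , first

      First⊎repeated : ∀ s l → s + l ≤ n → First s l ⊎ ∃[ t ] (t < s × Match l t s)
      First⊎repeated s l h with search s (occ? l s h)
      ... | inj₁ none = inj₁ λ t t<s m → none t t<s (≤-trans (+-monoˡ-≤ l (<⇒≤ t<s)) h , m)
      ... | inj₂ (t , t<s , (_ , m) , _) = inj₂ (t , t<s , m)

      sameEdge? : ∀ {e e′} → IsEdge w e → IsEdge w e′ → Dec (SameEdge w e e′)
      sameEdge? ie ie′ with IsEdge⇒EdgeAt ie | IsEdge⇒EdgeAt ie′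
      ... | s , l , e@(h , _) , _ | s′ , l′ , e′@(h′ , _) , _ = map′ (fac≡⇒SameEdge e e′) (SameEdge⇒fac≡ e e′) fac≡?
        where
        fac≡? : Dec (fac s (suc l) ≡ fac s′ (suc l′))
        fac≡? with l ≟ l′
        ... | no l≢l′ = no λ eq → l≢l′ (suc-injective (proj₁ (fac-injective eq)))
        ... | yes refl = map′ Match⇒fac≡ (fac≡⇒Match (suc l) s s′)
          (match? (suc l) s s′ (subst (_≤ n) (sym (+-suc s l)) h) (subst (_≤ n) (sym (+-suc s′ l)) h′))

      end? : ∀ s l → s + l ≤ n → ∀ i → Dec (End s l i)
      end? s l h i with l ≤? i | i ≤? n
      ... | no l≰i | _ = no λ { (t , refl , _) → l≰i (m≤n+m l t) }
      ... | yes _ | no i≰n = no λ (_ , _ , i≤n , _) → i≰n i≤n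
      ... | yes l≤i | yes i≤n =
        map′ (λ m → i ∸ l , m∸n+n≡m l≤i , i≤n , m)
             (λ { (t , refl , _ , m) → subst (λ r → Match l r s) (sym (m+n∸n≡m t l)) m })
             (match? l (i ∸ l) s (≤-trans (≤-reflexive (m∸n+n≡m l≤i)) i≤n) h)

      ≡R? : ∀ {x y} → PFactor w x → PFactor w y → Dec (x ≡R[ w ] y)
      ≡R? px py with PFactor⇒fac px | PFactor⇒fac py
      ... | s , l , h , refl | t , k , h′ , refl
        with allUpTo? (λ i → (end? s l h i →-dec end? t k h′ i) ×-dec (end? t k h′ i →-dec end? s l h i)) (suc n)
      ... | yes agree = yes (End⇔⇒≡R (λ e@(_ , _ , i≤n , _) → proj₁ (agree (s≤s i≤n)) e)
                                     (λ e@(_ , _ , i≤n , _) → proj₂ (agree (s≤s i≤n)) e))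
      ... | no ¬agree = no λ e → ¬agree λ _ → ≡R⇒End e , ≡R⇒End (≡R-sym e)

      -- Upper bounds for the word.

      nodes-bound : 3 ≤ n → ∀ xs → All (PFactor w) xs → AllPairs (λ x y → ¬ (x ≡R[ w ] y)) xs →
                    length xs ≤ 2 * n ∸ 1
      nodes-bound 3≤n xs Pxs distinct = subst (length xs ≤_) (count 3≤n)
        -- Prefix lengths run from 0 to `n`, ends of repeated suffixes from 3 to `n`; the third
        -- range is empty.
        (distinct⇒≤sum (suc n) (n ∸ 2) 0 Code code (λ {_} {_} {k} → func k) xs Pxs distinct)
        where
        Code : List PVSym → ℕ ⊎ ℕ ⊎ ℕ → Set
        Code x (inj₁ i)        = NodeCode x (inj₁ i)
        Code x (inj₂ (inj₁ j)) = NodeCode x (inj₂ j)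
        Code x (inj₂ (inj₂ _)) = ⊥
        code : ∀ {x} → PFactor w x → ∃[ k ] (Within (suc n) (n ∸ 2) 0 k × Code x k)
        code px with PFactor⇒NodeCode px
        ... | inj₁ i , c@(i≤n , _) = inj₁ i , s≤s i≤n , c
        ... | inj₂ j , c@(_ , _ , (h , _) , _ , end , _) =
          inj₂ (inj₁ j) , ∸-monoˡ-≤ 2 (≤-trans (≤-reflexive (sym end)) h) , c
        func : ∀ {x y} k → Code x k → Code y k → x ≡R[ w ] y
        func (inj₁ i)        = NodeCode-functional (inj₁ i)
        func (inj₂ (inj₁ j)) = NodeCode-functional (inj₂ j)
        count : ∀ {N} → 3 ≤ N → suc N + (N ∸ 2 + 0) ≡ 2 * N ∸ 1
        count (s≤s (s≤s (s≤s (z≤n {N})))) = solve N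
          where
          solve : ∀ N → suc (3 + N) + (suc N + 0) ≡ 2 + N + (3 + N + 0)
          solve = solve-∀

      -- A match of length one compares re-encoded letters, so any two parameters count as equal
      -- here.
      LastRepeats : Set
      LastRepeats = ∃[ t ] (t < n ∸ 1 × Match 1 t (n ∸ 1))

      -- Read `m c` at its first occurrence. If `m` occurs earlier, then no earlier occurrence of it
      -- continues with `c`, so `m` is the longest previous factor there.
      IsEdge⇒EdgeCode : ∀ {e} → IsEdge w e → ∃[ k ] (Within n (n ∸ 2) (n ∸ 1) k × EdgeCode e k)
      IsEdge⇒EdgeCode ie with IsEdge⇒EdgeAt ie
      ... | s , l , eAt@(h , _) , fresh with First⊎repeated s l (<⇒≤ h)
      IsEdge⇒EdgeCode ie | suc s , l , eAt@(h , _) , fresh | inj₂ repeated =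
        inj₂ (inj₂ s) , ∸-monoˡ-≤ 1 (≤-trans (s≤s (m≤m+n (suc s) l)) h) , l , eAt , repeated , fresh
      IsEdge⇒EdgeCode ie | s , l , eAt@(h , _) , fresh | inj₁ first with first⇒NodeCode s l (<⇒≤ h) first
      -- The prefix of length `i` ends at `s + l < n` as `m` does, which excludes the whole word.
      ... | inj₁ i , c@(_ , m≡) = inj₁ i , ≤-<-trans i≤ h , s , l , eAt , first , c
        where
        i≤ : i ≤ s + l
        i≤ with t , eq , _ ← ≡R⇒End m≡ (End-self (<⇒≤ h)) = ≤-trans (m≤n+m i t) (≤-reflexive eq)
      ... | inj₂ j , c@(_ , _ , (h′ , _) , _ , end , _) =
        inj₂ (inj₁ j) , ∸-monoˡ-≤ 2 (≤-trans (≤-reflexive (sym end)) h′) , s , l , eAt , first , c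

      -- If the last letter occurs earlier, the suffix of length one is a repetition that cannot be
      -- extended; otherwise the longest repeated suffix of w is empty. Either way one code is unused.
      IsEdge⇒EdgeCode-repeats : LastRepeats → ∀ {e} → IsEdge w e →
                                ∃[ k ] (Within n (n ∸ 2) (n ∸ 2) k × EdgeCode e k)
      IsEdge⇒EdgeCode-repeats (t , t< , m) ie with IsEdge⇒EdgeCode ie
      ... | inj₁ i , within , c = inj₁ i , within , c
      ... | inj₂ (inj₁ j) , within , c = inj₂ (inj₁ j) , within , c
      ... | inj₂ (inj₂ s) , within , c@(l , (h , _) , _ , fresh) with suc s ≟ n ∸ 1
      ...   | no s≢ = inj₂ (inj₂ s) , ≤-trans (∸-monoˡ-≤ 1 (≤∧≢⇒< within s≢)) (≤-reflexive (∸-+-assoc n 1 1)) , c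
      ...   | yes s≡ = ⊥-elim (fresh t (≤-trans t< (≤-reflexive (sym s≡)))
                (subst₂ (λ k r → Match k t r) (sym (cong suc l≡0)) (sym s≡) m))
        where
        l≡0 : l ≡ 0
        l≡0 = n≤0⇒n≡0 (+-cancelˡ-≤ (suc s) l 0
          (≤-trans (∸-monoˡ-≤ 1 h) (≤-reflexive (trans (sym s≡) (sym (+-identityʳ (suc s)))))))

      IsEdge⇒EdgeCode-fresh : ¬ LastRepeats → ∀ {e} → IsEdge w e →
                              ∃[ k ] (Within n (n ∸ 3) (n ∸ 1) k × EdgeCode e k)
      IsEdge⇒EdgeCode-fresh ¬rep ie with IsEdge⇒EdgeCode ie
      ... | inj₁ i , within , c = inj₁ i , within , c
      ... | inj₂ (inj₂ s) , within , c = inj₂ (inj₂ s) , within , c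
      ... | inj₂ (inj₁ j) , within , c@(_ , _ , _ , _ , t , suc l , (h , (s , s<t , m) , _) , _ , end , _)
        with 3 + j ≟ n
      ...   | no j≢ = inj₂ (inj₁ j) , ∸-monoˡ-≤ 3 (≤∧≢⇒< (≤-trans (≤-reflexive (sym end)) h) j≢) , c
      -- A nonempty repeated suffix of the whole word contains the last letter; dropping its first
      -- `l` letters exhibits an earlier occurrence of that letter.
      ...   | yes j≡ = ⊥-elim (¬rep (l + s , <-≤-trans (+-monoʳ-< l s<t) (≤-reflexive last) ,
                subst (Match 1 (l + s)) last (Match-drop l (subst (λ k → Match k s (suc t)) (+-comm 1 l) m))))
        where
        last : l + suc t ≡ n ∸ 1
        last = trans (+-comm l (suc t)) (cong (_∸ 1) (trans (sym (+-suc (suc t) l)) (trans end j≡)))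

      edges-bound : 3 ≤ n → ∀ es → All (IsEdge w) es → AllPairs (λ e e′ → ¬ SameEdge w e e′) es →
                    length es ≤ 3 * n ∸ 4
      -- The ranges add up to `3 * n ∸ 4` in both cases: `n`, `n - 2`, `n - 2` if the last letter
      -- repeats, and `n`, `n - 3`, `n - 1` if it does not.
      edges-bound 3≤n es Pes distinct with First⊎repeated (n ∸ 1) 1 (≤-reflexive (m∸n+n≡m (≤-trans (s≤s z≤n) 3≤n)))
      ... | inj₂ rep = subst (length es ≤_) (count 3≤n)
        (distinct⇒≤sum n (n ∸ 2) (n ∸ 2) EdgeCode (IsEdge⇒EdgeCode-repeats rep)
          (λ {_} {_} {k} → EdgeCode-functional k) es Pes distinct)
        where
        count : ∀ {N} → 3 ≤ N → N + (N ∸ 2 + (N ∸ 2)) ≡ 3 * N ∸ 4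
        count (s≤s (s≤s (s≤s (z≤n {N})))) = trans (sym (m+n∸n≡m _ 4)) (cong (_∸ 4) (solve N))
          where
          solve : ∀ N → 3 + N + (suc N + suc N) + 4 ≡ 3 * (3 + N)
          solve = solve-∀
      ... | inj₁ fresh = subst (length es ≤_) (count 3≤n)
        (distinct⇒≤sum n (n ∸ 3) (n ∸ 1) EdgeCode (IsEdge⇒EdgeCode-fresh λ (t , t< , m) → fresh t t< m)
          (λ {_} {_} {k} → EdgeCode-functional k) es Pes distinct)
        where
        count : ∀ {N} → 3 ≤ N → N + (N ∸ 3 + (N ∸ 1)) ≡ 3 * N ∸ 4
        count (s≤s (s≤s (s≤s (z≤n {N})))) = trans (sym (m+n∸n≡m _ 4)) (cong (_∸ 4) (solve N))
          where
          solve : ∀ N → 3 + N + (N + (2 + N)) + 4 ≡ 3 * (3 + N)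
          solve = solve-∀

    -- Words that attain the bounds.

    HeadUnique : Set
    HeadUnique = ∀ {l s} → suc s < n → ¬ Match (suc l) 0 (suc s)

    -- The `k` letters after the head behave like a power of one letter, once factors are
    -- re-encoded.
    UniformBlock : ℕ → Set
    UniformBlock k = ∀ s l → s + l ≤ k → Match l (suc s) 1

    module TightNodes (m : ℕ) (n≡ : n ≡ 3 + m) (letter? : ∀ p p′ → p < n → p′ < n → Dec (at w p ≡ at w p′))
                      (¬Match-head : HeadUnique) (Match-block : UniformBlock (2 + m)) where
      open DecidableLetters letter?

      -- Prefixes have lengths 0 to `n`, blocks lengths 1 to `n - 2`. The block of length `n - 1`
      -- ends only at `n` and so lies in the class of the whole word.
      prefixes blocks xs : List (List PVSym)
      prefixes = applyUpTo (fac 0) (4 + m)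
      blocks   = applyUpTo (fac 1 ∘ suc) (1 + m)
      xs       = prefixes ++ blocks

      ≤n : ∀ {i} → i ≤ 3 + m → i ≤ n
      ≤n h = ≤-trans h (≤-reflexive (sym n≡))

      Pxs : All (PFactor w) xs
      Pxs = Allₚ.++⁺ (Allₚ.applyUpTo⁺₁ _ (4 + m) λ i< → fac-PFactor 0 _ (≤n (s≤s⁻¹ i<)))
                     (Allₚ.applyUpTo⁺₁ _ (1 + m) λ i< → fac-PFactor 1 _ (≤n (s≤s (m<n⇒m<1+n i<))))

      prefix≢prefix : ∀ {i j} → i < j → j < 4 + m → ¬ (fac 0 i ≡R[ w ] fac 0 j)
      prefix≢prefix {i} {j} i<j j< e with ≡R⇒End e (End-self {0} {i} (≤n (≤-trans (<⇒≤ i<j) (s≤s⁻¹ j<))))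
      ... | t , eq , _ = <⇒≱ i<j (≤-trans (m≤n+m j t) (≤-reflexive eq))

      block≢block : ∀ {i j} → i < j → j < 1 + m → ¬ (fac 1 (suc i) ≡R[ w ] fac 1 (suc j))
      block≢block {i} {j} i<j j< e with ≡R⇒End e (End-self {1} {suc i} (≤n (s≤s (m<n⇒m<1+n (<-trans i<j j<)))))
      ... | zero  , _  , _ , match = ¬Match-head (≤n (s≤s (s≤s z≤n))) match
      ... | suc t , eq , _ = <⇒≱ i<j (s≤s⁻¹ (≤-trans (m≤n+m (suc j) t) (≤-reflexive (suc-injective eq))))

      -- Such a block occurs at starts 1 and 2, whereas a nonempty prefix occurs only at 0 because
      -- the head does not recur. The empty prefix is told apart by its end 0.
      prefix≢block : ∀ {i j} → i < 4 + m → j < 1 + m → ¬ (fac 0 i ≡R[ w ] fac 1 (suc j))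
      prefix≢block {zero} {j} _ _ e with ≡R⇒End e (End-self {0} {0} z≤n)
      ... | t , eq , _ with trans (sym (+-suc t j)) eq
      ...   | ()
      prefix≢block {suc i} {j} _ (s≤s j≤m) e
        with ≡R⇒End (≡R-sym e) (2 , refl , ≤n (s≤s (s≤s (s≤s j≤m))) , Match-block 1 (suc j) (s≤s (s≤s j≤m)))
      ... | suc t , eq , h , match = ¬Match-head
              (≤-trans (≤-trans (≤-reflexive (+-comm 1 (suc t))) (+-monoʳ-≤ (suc t) (s≤s z≤n))) (≤-trans (≤-reflexive eq) h))
              (Match-sym match)
      ... | zero , refl , _ with ≡R⇒End (≡R-sym e) (End-self {1} {suc j} (≤n (s≤s (s≤s (≤-trans j≤m (n≤1+n m))))))
      ...   | t , eq , _ = <⇒≱ ≤-refl (≤-trans (m≤n+m (3 + j) t) (≤-reflexive eq))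

      distinct : AllPairs (λ x y → ¬ (x ≡R[ w ] y)) xs
      distinct = AllPairsₚ.++⁺ (AllPairsₚ.applyUpTo⁺₁ _ _ prefix≢prefix) (AllPairsₚ.applyUpTo⁺₁ _ _ block≢block)
        (Allₚ.applyUpTo⁺₁ _ _ λ i< → Allₚ.applyUpTo⁺₁ _ _ λ j< → prefix≢block i< j<)

      length-xs : length xs ≡ 2 * (3 + m) ∸ 1
      length-xs = trans (length-++ prefixes)
        (trans (cong₂ _+_ (length-applyUpTo (fac 0) (4 + m)) (length-applyUpTo (fac 1 ∘ suc) (1 + m))) (count m))
        where
        count : ∀ m → 4 + m + (1 + m) ≡ 2 + m + (3 + m + 0)
        count = solve-∀

      -- The list already attains the upper bound, so no node is missing.
      exhaustive : ∀ y → PFactor w y → Any (λ x → x ≡R[ w ] y) xs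
      exhaustive = maximal⇒exhaustive ≡R? ≡R-sym xs Pxs distinct λ ys Pys dys →
        ≤-trans (nodes-bound (≤n (s≤s (s≤s (s≤s z≤n)))) ys Pys dys)
                (≤-reflexive (trans (cong (λ N → 2 * N ∸ 1) n≡) (sym length-xs)))

      exactNodes : ExactNodes w (2 * (3 + m) ∸ 1)
      exactNodes = xs , (Pxs , distinct) , exhaustive , length-xs

    module TightEdges (m : ℕ) (n≡ : n ≡ 3 + m) (letter? : ∀ p p′ → p < n → p′ < n → Dec (at w p ≡ at w p′))
                      (¬Match-head : HeadUnique) (Match-block : UniformBlock (suc m))
                      (b : StSym) (block-≢b : ∀ {r} → r < suc m → at w (suc r) ≢ inj₁ b)
                      (last≡b : at w (2 + m) ≡ inj₁ b) where
      open DecidableLetters letter?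

      ≤n : ∀ {i} → i ≤ 3 + m → i ≤ n
      ≤n h = ≤-trans h (≤-reflexive (sym n≡))

      edge : ℕ → ℕ → Edge
      edge s l = fac s l , Z (at w (s + l)) l , fac s (suc l)

      -- From here exactly `j` letters of the block remain before the final `b`, for `j` up to
      -- `suc m`.
      start : ℕ → ℕ
      start j = suc (suc m ∸ j)

      prefixes blocks exits es : List Edge
      prefixes = applyUpTo (edge 0) (3 + m)
      blocks   = applyUpTo (edge 1) (1 + m)
      exits    = applyUpTo (λ j → edge (start j) j) (1 + m)
      es       = prefixes ++ blocks ++ exits

      IsMax : ℕ → ℕ → Set
      IsMax s l = s + l < n × (∀ z → z ≡R[ w ] fac s l → length z ≤ l)

      -- Every string in the class ends at `i`, which leaves room for length `i` at most.
      prefix-max : ∀ {i} → i < 3 + m → IsMax 0 i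
      prefix-max {i} i< = ≤n i< , λ z e → proj₁ (proj₂ (proj₂ (e i) (End⇒RPos (End-self (≤n (<⇒≤ i<))))))

      -- The block ends at `1 + l` and `2 + l`. A longer string with these ends would have length
      -- `suc l` and start at both 0 and 1, so the head would recur.
      block-max : ∀ {r l} → r + l ≤ suc m → l < suc m → IsMax (suc r) l
      block-max {r} {l} h l< = ≤n (s≤s (s≤s h)) , longest
        where
        end : ∀ s → s + l ≤ suc m → End (suc r) l (suc s + l)
        end s hs = suc s , refl , ≤n (m≤n⇒m≤1+n (s≤s hs)) , Match-trans (Match-block s l hs) (Match-sym (Match-block r l h))
        longest : ∀ z → z ≡R[ w ] fac (suc r) l → length z ≤ l
        longest z e = ≮⇒≥ λ l<z →
          let t , eq , _ , z≡ = RPos⇒fac (proj₂ (e (1 + l)) (End⇒RPos (end 0 (<⇒≤ l<))))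
              t′ , eq′ , _ , z≡′ = RPos⇒fac (proj₂ (e (2 + l)) (End⇒RPos (end 1 l<)))
              z-len : length z ≡ suc l
              z-len = ≤-antisym (≤-trans (m≤n+m _ t) (≤-reflexive eq)) l<z
              t≡0 : t ≡ 0
              t≡0 = +-cancelʳ-≡ (length z) t 0 (trans eq (sym z-len))
              t′≡1 : t′ ≡ 1
              t′≡1 = +-cancelʳ-≡ (length z) t′ 1 (trans eq′ (cong suc (sym z-len)))
          in ¬Match-head (≤n (s≤s (s≤s z≤n))) (subst (λ k → Match k 0 1) z-len
               (fac≡⇒Match (length z) 0 1
                 (subst₂ (λ p p′ → fac p (length z) ≡ fac p′ (length z)) t≡0 t′≡1 (trans (sym z≡) z≡′))))

      exit-end : ∀ {j} → j < suc m → suc m ∸ j + j ≡ suc m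
      exit-end j< = m∸n+n≡m (<⇒≤ j<)

      exit-max : ∀ {j} → j < suc m → IsMax (start j) j
      exit-max j< = block-max (≤-reflexive (exit-end j<)) j<

      EdgeAt-edge : ∀ {s l} → IsMax s l → EdgeAt (edge s l) s l
      EdgeAt-edge {s} {l} (h , max) = h , fac-PFactor s l (<⇒≤ h) ,
        (≡R-refl , λ z e → ≤-trans (max z e) (≤-reflexive (sym (length-fac s l)))) , refl , ≡R-refl

      IsEdge-edge : ∀ {s l} → IsMax s l → IsEdge w (edge s l)
      IsEdge-edge {s} {l} max with EdgeAt-edge max
      ... | h , px , isMax , _ , _ = px , fac-PFactor s (suc l) (≤-trans (≤-reflexive (+-suc s l)) h) ,
                                     fac s l , isMax , ≡R-reflexive (fac-∷ʳ s l)

      Pes : All (IsEdge w) es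
      Pes = Allₚ.++⁺ (Allₚ.applyUpTo⁺₁ _ _ (IsEdge-edge ∘ prefix-max))
           (Allₚ.++⁺ (Allₚ.applyUpTo⁺₁ _ _ λ j< → IsEdge-edge (block-max (<⇒≤ j<) j<))
                     (Allₚ.applyUpTo⁺₁ _ _ (IsEdge-edge ∘ exit-max)))

      same⇒Match : ∀ {s l s′ l′} → IsMax s l → IsMax s′ l′ → SameEdge w (edge s l) (edge s′ l′) →
                   suc l ≡ suc l′ × Match (suc l) s s′
      same⇒Match max max′ same = fac-injective (SameEdge⇒fac≡ (EdgeAt-edge max) (EdgeAt-edge max′) same)

      lengths-differ : ∀ {s l s′ l′} → IsMax s l → IsMax s′ l′ → l < l′ → ¬ SameEdge w (edge s l) (edge s′ l′)
      lengths-differ max max′ l<l′ same = <⇒≢ l<l′ (suc-injective (proj₁ (same⇒Match max max′ same)))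

      prefix≢other : ∀ {i s l} → IsMax 0 i → IsMax (suc s) l → ¬ SameEdge w (edge 0 i) (edge (suc s) l)
      prefix≢other {s = s} {l} max max′@(h , _) same =
        ¬Match-head (≤-trans (s≤s (m≤m+n (suc s) l)) h) (proj₂ (same⇒Match max max′ same))

      -- The labels differ: an exit edge reads the final `b`, a block edge a letter of the block.
      block≢exit : ∀ {i j} → i < suc m → j < suc m → ¬ SameEdge w (edge 1 i) (edge (start j) j)
      block≢exit i< j< same with same⇒Match (block-max (<⇒≤ i<) i<) (exit-max j<) same
      ... | refl , match = block-≢b i< (Z-static _ _ (trans (match _ ≤-refl)
              (cong (λ c → Z c _) (trans (cong (at w ∘ suc) (exit-end j<)) last≡b))))

      distinct : AllPairs (λ e e′ → ¬ SameEdge w e e′) es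
      distinct = AllPairsₚ.++⁺
        (AllPairsₚ.applyUpTo⁺₁ _ _ λ i<j j< → lengths-differ (prefix-max (<-trans i<j j<)) (prefix-max j<) i<j)
        (AllPairsₚ.++⁺
          (AllPairsₚ.applyUpTo⁺₁ _ _ λ i<j j< → let i< = <-trans i<j j< in
            lengths-differ (block-max (<⇒≤ i<) i<) (block-max (<⇒≤ j<) j<) i<j)
          (AllPairsₚ.applyUpTo⁺₁ _ _ λ i<j j< → lengths-differ (exit-max (<-trans i<j j<)) (exit-max j<) i<j)
          (Allₚ.applyUpTo⁺₁ _ _ λ i< → Allₚ.applyUpTo⁺₁ _ _ λ j< → block≢exit i< j<))
        (Allₚ.applyUpTo⁺₁ _ _ λ i< → Allₚ.++⁺
          (Allₚ.applyUpTo⁺₁ _ _ λ j< → prefix≢other (prefix-max i<) (block-max (<⇒≤ j<) j<))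
          (Allₚ.applyUpTo⁺₁ _ _ λ j< → prefix≢other (prefix-max i<) (exit-max j<)))

      length-es : length es ≡ 3 * (3 + m) ∸ 4
      length-es = trans (trans (length-++ prefixes) (cong₂ _+_ (length-applyUpTo (edge 0) (3 + m))
        (trans (length-++ blocks) (cong₂ _+_ (length-applyUpTo (edge 1) (1 + m))
          (length-applyUpTo (λ j → edge (start j) j) (1 + m))))))
        (trans (sym (m+n∸n≡m _ 4)) (cong (_∸ 4) (count m)))
        where
        count : ∀ m → 3 + m + (1 + m + (1 + m)) + 4 ≡ 3 * (3 + m)
        count = solve-∀

      exhaustive : ∀ e → IsEdge w e → Any (λ e′ → SameEdge w e′ e) es
      exhaustive = maximal⇒exhaustive sameEdge? SameEdge-sym es Pes distinct λ fs Pfs dfs →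
        ≤-trans (edges-bound (≤n (s≤s (s≤s (s≤s z≤n)))) fs Pfs dfs)
                (≤-reflexive (trans (cong (λ N → 3 * N ∸ 4) n≡) (sym length-es)))

      exactEdges : ExactEdges w (3 * (3 + m) ∸ 4)
      exactEdges = es , (Pes , distinct) , exhaustive , length-es

    ¬¬-letters : ¬ ¬ (∀ p p′ → p < n → p′ < n → Dec (at w p ≡ at w p′))
    ¬¬-letters r = ¬¬-bounded n (λ p → ¬¬-bounded n (λ p′ → ¬¬-excluded-middle))
      λ dec → r λ p p′ p< p′< → dec p p< p′ p′<

  -- From words to p-strings.

  prevFrom-length : ∀ h T → length (prevFrom h T) ≡ length T
  prevFrom-length h []           = refl
  prevFrom-length h (inj₁ s ∷ T) = cong suc (prevFrom-length (inj₁ s ∷ h) T)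
  prevFrom-length h (inj₂ p ∷ T) = cong suc (prevFrom-length (inj₂ p ∷ h) T)

  -- Equality of static symbols need not be decidable, but the bounds are stable propositions.
  nodesAtMost : ∀ T → 3 ≤ length T → NodesAtMost T (2 * length T ∸ 1)
  nodesAtMost T 3≤ xs (Pxs , distinct) rewrite sym (prevFrom-length [] T) =
    decidable-stable (_ ≤? _) λ ¬bound → ¬¬-letters λ letter? →
      ¬bound (DecidableLetters.nodes-bound letter? 3≤ xs Pxs distinct)
    where open Word (prev T)

  edgesAtMost : ∀ T → 3 ≤ length T → EdgesAtMost T (3 * length T ∸ 4)
  edgesAtMost T 3≤ es (Pes , distinct) rewrite sym (prevFrom-length [] T) =
    decidable-stable (_ ≤? _) λ ¬bound → ¬¬-letters λ letter? →
      ¬bound (DecidableLetters.edges-bound letter? 3≤ es Pes distinct)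
    where open Word (prev T)

  at-All : {P : PVSym → Set} → ∀ {w} → All P w → ∀ {p} → p < length w → P (at w p)
  at-All (px ∷ _)   {zero}  _       = px
  at-All (_  ∷ pxs) {suc p} (s≤s h) = at-All pxs h

  at-replicate : ∀ k g v {r} → r < k → at (replicate k g ++ v) r ≡ g
  at-replicate (suc k) g v {zero}  _       = refl
  at-replicate (suc k) g v {suc r} (s≤s h) = at-replicate k g v h

  at-replicate-++ : ∀ k g v → at (replicate k g ++ v) k ≡ at v 0
  at-replicate-++ zero    g v = refl
  at-replicate-++ (suc k) g v = at-replicate-++ k g v

  -- The extremal texts.

  -- The prev-encodings of the first letter and of the later letters of a block u u ... u.
  first later : PSym → PVSym
  first (inj₁ s) = inj₁ s
  first (inj₂ _) = inj₂ 0
  later (inj₁ s) = inj₁ s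
  later (inj₂ _) = inj₂ 1

  -- The first `u` is written apart from the `k` later ones because a parameter is encoded
  -- differently there.
  blockText : StSym → PSym → ℕ → List StSym → List PSym
  blockText a u k v = inj₁ a ∷ u ∷ replicate k u ++ map inj₁ v

  blockWord : StSym → PSym → ℕ → List StSym → List PVSym
  blockWord a u k v = inj₁ a ∷ first u ∷ replicate k (later u) ++ map inj₁ v

  prevFrom-static : ∀ h v → prevFrom h (map inj₁ v) ≡ map inj₁ v
  prevFrom-static h []      = refl
  prevFrom-static h (s ∷ v) = cong (inj₁ s ∷_) (prevFrom-static _ v)

  prevFrom-later : ∀ u h k v → prevFrom (u ∷ h) (replicate k u ++ map inj₁ v) ≡ replicate k (later u) ++ map inj₁ v
  prevFrom-later u        h zero    v = prevFrom-static (u ∷ h) v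
  prevFrom-later (inj₁ s) h (suc k) v = cong (inj₁ s ∷_) (prevFrom-later (inj₁ s) _ k v)
  prevFrom-later (inj₂ p) h (suc k) v = cong₂ _∷_ (cong inj₂ dist≡1) (prevFrom-later (inj₂ p) _ k v)
    where
    dist≡1 : dist p (inj₂ p ∷ h) ≡ 1
    dist≡1 with p ≟Π p
    ... | yes _ = refl
    ... | no p≢p = contradiction refl p≢p

  prev-blockText : ∀ a u k v → prev (blockText a u k v) ≡ blockWord a u k v
  prev-blockText a (inj₁ s) k v = cong (λ x → inj₁ a ∷ inj₁ s ∷ x) (prevFrom-later (inj₁ s) _ k v)
  prev-blockText a (inj₂ p) k v = cong (λ x → inj₁ a ∷ inj₂ 0 ∷ x) (prevFrom-later (inj₂ p) _ k v)

  first-≢ : ∀ {s} u → u ≢ inj₁ s → first u ≢ inj₁ s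
  first-≢ (inj₁ _) u≢s eq = u≢s (cong inj₁ (inj₁-injective eq))
  first-≢ (inj₂ _) u≢s ()

  later-≢ : ∀ {s} u → u ≢ inj₁ s → later u ≢ inj₁ s
  later-≢ (inj₁ _) u≢s eq = u≢s (cong inj₁ (inj₁-injective eq))
  later-≢ (inj₂ _) u≢s ()

  Z-first : ∀ u → Z (first u) 0 ≡ first u
  Z-first (inj₁ _) = refl
  Z-first (inj₂ _) = refl

  Z-later : ∀ u → Z (later u) 0 ≡ first u
  Z-later (inj₁ _) = refl
  Z-later (inj₂ _) = refl

  module Block (a b : StSym) (u : PSym) (a≟b : Dec (a ≡ b)) (u≢a : u ≢ inj₁ a) (u≢b : u ≢ inj₁ b)
               (k : ℕ) (v : List StSym) (v≡b : All (_≡ b) v) (v≢a : All (_≢ a) v) where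

    w : List PVSym
    w = blockWord a u k v

    open Word w

    length-w : n ≡ 2 + (k + length v)
    length-w = cong (2 +_) (trans (length-++ (replicate k (later u)))
      (cong₂ _+_ (length-replicate k) (length-map inj₁ v)))

    -- Equality on `StSym` need not be decidable, but the hypotheses on `a`, `b` and `u` decide it
    -- for the static symbols that can occur in `w`.
    Known : PVSym → Set
    Known (inj₁ s) = s ≡ a ⊎ s ≡ b ⊎ inj₁ s ≡ u
    Known (inj₂ _) = ⊤

    known≡? : ∀ c d → Known c → Known d → Dec (c ≡ d)
    known≡? (inj₁ _) (inj₁ _) (inj₁ refl)        (inj₁ refl)        = yes refl
    known≡? (inj₁ _) (inj₁ _) (inj₁ refl)        (inj₂ (inj₁ refl)) = map′ (cong inj₁) inj₁-injective a≟b
    known≡? (inj₁ _) (inj₁ _) (inj₁ refl)        (inj₂ (inj₂ refl)) = no (u≢a ∘ cong inj₁ ∘ sym ∘ inj₁-injective)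
    known≡? (inj₁ _) (inj₁ _) (inj₂ (inj₁ refl)) (inj₁ refl)        = map′ (cong inj₁ ∘ sym) (sym ∘ inj₁-injective) a≟b
    known≡? (inj₁ _) (inj₁ _) (inj₂ (inj₁ refl)) (inj₂ (inj₁ refl)) = yes refl
    known≡? (inj₁ _) (inj₁ _) (inj₂ (inj₁ refl)) (inj₂ (inj₂ refl)) = no (u≢b ∘ cong inj₁ ∘ sym ∘ inj₁-injective)
    known≡? (inj₁ _) (inj₁ _) (inj₂ (inj₂ refl)) (inj₁ refl)        = no (u≢a ∘ cong inj₁ ∘ inj₁-injective)
    known≡? (inj₁ _) (inj₁ _) (inj₂ (inj₂ refl)) (inj₂ (inj₁ refl)) = no (u≢b ∘ cong inj₁ ∘ inj₁-injective)
    known≡? (inj₁ _) (inj₁ _) (inj₂ (inj₂ refl)) (inj₂ (inj₂ refl)) = yes refl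
    known≡? (inj₁ _) (inj₂ _) _ _ = no λ ()
    known≡? (inj₂ _) (inj₁ _) _ _ = no λ ()
    known≡? (inj₂ i) (inj₂ j) _ _ = map′ (cong inj₂) inj₂-injective (i ≟ j)

    all-known : All Known w
    all-known = inj₁ refl ∷ first-known u refl ∷
      Allₚ.++⁺ (Allₚ.replicate⁺ k (later-known u refl)) (Allₚ.map⁺ (All.map (inj₂ ∘ inj₁) v≡b))
      where
      first-known : ∀ u′ → u′ ≡ u → Known (first u′)
      first-known (inj₁ _) eq = inj₂ (inj₂ eq)
      first-known (inj₂ _) _  = tt
      later-known : ∀ u′ → u′ ≡ u → Known (later u′)
      later-known (inj₁ _) eq = inj₂ (inj₂ eq)
      later-known (inj₂ _) _  = tt

    letter? : ∀ p p′ → p < n → p′ < n → Dec (at w p ≡ at w p′)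
    letter? p p′ h h′ = known≡? _ _ (at-All all-known h) (at-All all-known h′)

    ¬Match-head : HeadUnique
    ¬Match-head {l} {s} (s≤s h) m = at-All tail≢a (subst (_< _) (sym (+-identityʳ s)) h)
      (Z-static _ 0 (sym (m 0 (s≤s z≤n))))
      where
      tail≢a : All (_≢ inj₁ a) (first u ∷ replicate k (later u) ++ map inj₁ v)
      tail≢a = first-≢ u u≢a ∷
        Allₚ.++⁺ (Allₚ.replicate⁺ k (later-≢ u u≢a)) (Allₚ.map⁺ (All.map (_∘ inj₁-injective) v≢a))

    at-later : ∀ {r} → r < k → at w (2 + r) ≡ later u
    at-later = at-replicate k (later u) (map inj₁ v)

    block-≢b : ∀ {r} → r < suc k → at w (suc r) ≢ inj₁ b
    block-≢b {zero}  _       eq = first-≢ u u≢b eq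
    block-≢b {suc r} (s≤s h) eq = later-≢ u u≢b (trans (sym (at-later h)) eq)

    Z-block : ∀ {r} → r < suc k → Z (at w (suc r)) 0 ≡ first u
    Z-block {zero}  _       = Z-first u
    Z-block {suc r} (s≤s h) = trans (cong (λ c → Z c 0) (at-later h)) (Z-later u)

    -- The first letter of a factor in the block re-encodes to `first u` wherever it starts; all its
    -- other letters are literally `later u`.
    Match-block : UniformBlock (suc k)
    Match-block s l h zero    q<l = trans (Z-block (<-≤-trans (+-monoʳ-< s q<l) h)) (sym (Z-first u))
    Match-block s l h (suc q) q<l = cong (λ c → Z c (suc q))
      (trans (trans (cong (λ p → at w (suc p)) (+-suc s q)) (at-later s+q<k)) (sym (at-later (≤-<-trans (m≤n+m q s) s+q<k))))
      where
      s+q<k : s + q < k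
      s+q<k = s≤s⁻¹ (subst (_< suc k) (+-suc s q) (<-≤-trans (+-monoʳ-< s q<l) h))

  nodes-tight : ∀ a u → u ≢ inj₁ a → ∀ m → ExactNodes (blockWord a u (suc m) []) (2 * (3 + m) ∸ 1)
  nodes-tight a u u≢a m = Word.TightNodes.exactNodes w m
    (trans length-w (cong (3 +_) (+-identityʳ m))) letter? ¬Match-head Match-block
    -- The tail is empty, so `a` itself can stand in for `b`.
    where open Block a a u (yes refl) u≢a u≢a (suc m) [] [] []

  edges-tight : ∀ a b u → a ≢ b → u ≢ inj₁ a → u ≢ inj₁ b →
                ∀ m → ExactEdges (blockWord a u m (b ∷ [])) (3 * (3 + m) ∸ 4)
  edges-tight a b u a≢b u≢a u≢b m = Word.TightEdges.exactEdges w m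
    (trans length-w (cong (2 +_) (+-comm m 1))) letter? ¬Match-head Match-block
    b block-≢b (at-replicate-++ m (later u) _)
    where open Block a b u (no a≢b) u≢a u≢b m (b ∷ []) (refl ∷ []) ((a≢b ∘ sym) ∷ [])

  length-blockText : ∀ a u k v → length (blockText a u k v) ≡ 2 + (k + length v)
  length-blockText a u k v = cong (2 +_) (trans (length-++ (replicate k u))
    (cong₂ _+_ (length-replicate k) (length-map inj₁ v)))

theorem1 : (StSym PaSym : Set) (_≟Π_ : DecidableEquality PaSym)
    → let open PDAWG StSym PaSym _≟Π_ in
    (∀ (T : List PSym) → 3 ≤ length T
    → NodesAtMost T (2 * length T ∸ 1) × EdgesAtMost T (3 * length T ∸ 4))
    × ((a : StSym) (u : PSym) → u ≢ inj₁ a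
    → ∀ n → 3 ≤ n → ∃[ T ] (length T ≡ n × NodesExactly T (2 * n ∸ 1)))
    × ((a b : StSym) (u : PSym) → a ≢ b → u ≢ inj₁ a → u ≢ inj₁ b
    → ∀ n → 3 ≤ n → ∃[ T ] (length T ≡ n × EdgesExactly T (3 * n ∸ 4)))
theorem1 StSym PaSym _≟Π_ =
    (λ T 3≤n → nodesAtMost T 3≤n , edgesAtMost T 3≤n)
  , (λ { a u u≢a _ (s≤s (s≤s (s≤s (z≤n {m})))) → blockText a u (suc m) []
       , trans (length-blockText a u (suc m) []) (cong (3 +_) (+-identityʳ m))
       , subst (λ w → ExactNodes w (2 * (3 + m) ∸ 1)) (sym (prev-blockText a u (suc m) [])) (nodes-tight a u u≢a m) })
  , (λ { a b u a≢b u≢a u≢b _ (s≤s (s≤s (s≤s (z≤n {m})))) → blockText a u m (b ∷ [])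
       , trans (length-blockText a u m (b ∷ [])) (cong (2 +_) (+-comm m 1))
       , subst (λ w → ExactEdges w (3 * (3 + m) ∸ 4)) (sym (prev-blockText a u m (b ∷ [])))
           (edges-tight a b u a≢b u≢a u≢b m) })
  where open Words StSym PaSym _≟Π_
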